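{- Let $X$ be a type and $A:X\to\mathcal U_{\mathsf{Simp}}$ an iso-inner family that has locally cocartesian lifts and in which locally cocartesian edges compose (i.e. $\mathsf{hasLCCLifts}(A)$ and $\mathsf{LCCLiftsCompose}(A)$ hold). Then every locally cocartesian edge of $A$ is cocartesian, and $A$ is a cocartesian family.
   Context: Ambient framework: homotopy type theory extended with a set $\mathbb I$ which is a bounded distributive lattice $(0,1,\wedge,\vee)$ with $0\ne1$ (part of triangulated type theory). Shapes: $\Delta^2=\{(i,j):\mathbb I^2\mid i\ge j\}$, $\Lambda^2_1=\{(i,j)\mid i=1\vee j=0\}$, $\Lambda^2_0=\{(i,j)\mid i=j\vee j=0\}$, $\Lambda^2_2=\{(i,j)\mid i=1\vee i=j\}$; vertices $\bar0=(0,0),\bar1=(1,0),\bar2=(1,1)$. $\mathcal U_{\mathsf{Simp}}$ is the subuniverse of simplicial types ($A$ such that for all $i,j:\mathbb I$ the constant map $A\to(i\le j\vee j\le i\to A)$ is an equivalence). $\mathbb I_\cong=\Delta^2\sqcup_{\Lambda^2_2}\mathbb I\sqcup_{\Lambda^2_0}\Delta^2$. A family $A:X\to\mathcal U$ is identified with $\widetilde A=\sum_{x:X}A(x)\to X$; it is right orthogonal to $j:I\to J$ if $\widetilde A^J\to X^J\times_{X^I}\widetilde A^I$ is an equivalence; inner if right orthogonal to $\Lambda^2_1\hookrightarrow\Delta^2$; iso-inner if moreover right orthogonal to $\mathbb I_\cong\to1$. An arrow $f:\mathbb I\to\widetilde A$ is cocartesian if $\widetilde A^{\Delta^2}\to\widetilde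 A^{\Lambda^2_0}\times_{X^{\Lambda^2_0}}X^{\Delta^2}$, viewed as a map of families over $\widetilde A^{\mathbb I}$ by restricting to the edge $\bar0\to\bar1$, is an equivalence on fibers over $f$. $A$ is cocartesian if it is iso-inner, each $A(x)$ is simplicial, and for every $u:\mathbb I\to X$ and $a:A(u\,0)$ there is a cocartesian dependent arrow over $u$ starting at $a$. Locally cocartesian: for $A:\mathbb I\to\mathcal U$, $a:\prod_{i}A(i)$ is locally cocartesian if for all $b:\prod_iA(i)$ and $p:a\,0=b\,0$ the type of $t:\prod_{(i,j):\Delta^2}A(i)$ with $t|_{\Lambda^2_0}=[a,b,p]$ is contractible. $\mathsf{hasLCCLifts}(A)=\prod_{a_0:A(0)}\sum_{a}$($a\,0=a_0$ and $a$ locally cocartesian). For $A:\Delta^2\to\mathcal U$, $\mathsf{LCCLiftsCompose}(A)$ says that for all $a:\prod_{s:\Delta^2}A(s)$, if $a(-,0)$ and $a(1,-)$ are locally cocartesian then so is $i\mapsto a(i,i)$. For general $A:X\to\mathcal U$ these hold if they hold for $A\circ u$ for every $u:\mathbb I\to X$ (resp. for $A\circ h$ restricted to $\Delta^2$ for every $h:\mathbb I^2\to X$); an edge of $A$ over $u$ is locally cocartesian if it is so in $A\circ u$. -}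

{-# OPTIONS --without-K --safe #-}
module Defs where

open import Level using (Level; Setω; _⊔_) renaming (suc to lsuc; zero to lzero)
open import Algebra.Definitions using (RightIdentity)
import Algebra.Lattice.Structures as Lattice
open import Axiom.Extensionality.Propositional using (Extensionality)
open import Axiom.UniquenessOfIdentityProofs using (UIP)
open import Data.Product using (Σ; Σ-syntax; _×_; _,_; proj₁; proj₂)
open import Data.Unit using (⊤)
open import Function using (_∘_; id)
open import Relation.Binary.PropositionalEquality
open import Relation.Nullary using (Irrelevant)

private variable
  a b c d ℓ ℓ′ : Level

------------------------------------------------------------------------
-- Homotopy type theory

isContr : Set a → Set a
isContr A = Σ[ x ∈ A ] (∀ y → x ≡ y)

fiber : {A : Set a} {B : Set b} → (A → B) → B → Set (a ⊔ b)
fiber {A = A} f y = Σ[ x ∈ A ] f x ≡ y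

isEquiv : {A : Set a} {B : Set b} → (A → B) → Set (a ⊔ b)
isEquiv f = ∀ y → isContr (fiber f y)

_≃_ : Set a → Set b → Set (a ⊔ b)
A ≃ B = Σ (A → B) isEquiv

id-isEquiv : {A : Set a} → isEquiv {A = A} id
id-isEquiv y = (y , refl) , λ { (_ , refl) → refl }

idToEquiv : {A B : Set a} → A ≡ B → A ≃ B
idToEquiv refl = id , id-isEquiv

-- The constructors and the induction principle of the pushout W of f and g.
-- The computation rules on points hold only up to identity: an assumption
-- cannot provide judgemental ones.
record IsPushout {A : Set a} {B : Set b} {C : Set c} (f : C → A) (g : C → B)
                 (W : Set d) : Setω where
  field
    inl  : A → W
    inr  : B → W
    glue : ∀ z → inl (f z) ≡ inr (g z)

  Method : (W → Set ℓ) → Set (a ⊔ b ⊔ c ⊔ ℓ)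
  Method P = Σ[ l ∈ (∀ x → P (inl x)) ] Σ[ r ∈ (∀ y → P (inr y)) ]
             (∀ z → subst P (glue z) (l (f z)) ≡ r (g z))

  field
    elim      : (P : W → Set ℓ) → Method P → ∀ w → P w
    elim-inl  : (P : W → Set ℓ) (m@(l , r , h) : Method P) → ∀ x → elim P m (inl x) ≡ l x
    elim-inr  : (P : W → Set ℓ) (m@(l , r , h) : Method P) → ∀ y → elim P m (inr y) ≡ r y
    elim-glue : (P : W → Set ℓ) (m@(l , r , h) : Method P) → ∀ z →
                trans (dcong (elim P m) (glue z)) (elim-inr P m (g z))
                ≡ trans (cong (subst P (glue z)) (elim-inl P m (f z))) (h z)

  rec : {Y : Set ℓ} (l : A → Y) (r : B → Y) → (∀ z → l (f z) ≡ r (g z)) → W → Y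
  rec {Y = Y} l r h = elim (λ _ → Y) (l , r , λ z → trans (subst-const (glue z)) (h z))
    where
    subst-const : ∀ {v w : W} (p : v ≡ w) {y : Y} → subst (λ _ → Y) p y ≡ y
    subst-const refl = refl

-- What homotopy type theory adds to intensional type theory, as far as it is
-- used here.
record HoTT : Setω where
  field
    funext     : ∀ {a b} → Extensionality a b
    univalence : {A B : Set a} → isEquiv (idToEquiv {A = A} {B = B})
    Pushout    : {A : Set a} {B : Set b} {C : Set c} →
                 (C → A) → (C → B) → Set (a ⊔ b ⊔ c)
    isPushout  : {A : Set a} {B : Set b} {C : Set c} (f : C → A) (g : C → B) →
                 IsPushout f g (Pushout f g)

  module _ {A : Set a} {B : Set b} {C : Set c} {f : C → A} {g : C → B} where
    open IsPushout (isPushout f g) public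

------------------------------------------------------------------------
-- The interval: a set with a bounded distributive lattice structure, 0 ≢ 1

record Interval : Set₁ where
  infixr 7 _∧_
  infixr 6 _∨_
  field
    𝕀     : Set
    𝕀-set : UIP 𝕀
    _∧_ _∨_ : 𝕀 → 𝕀 → 𝕀
    0ᴵ 1ᴵ : 𝕀
    isDistributiveLattice : Lattice.IsDistributiveLattice _≡_ _∨_ _∧_
    ∧-identityʳ : RightIdentity _≡_ 1ᴵ _∧_
    ∨-identityʳ : RightIdentity _≡_ 0ᴵ _∨_
    0≢1 : 0ᴵ ≢ 1ᴵ

  open Lattice.IsDistributiveLattice isDistributiveLattice public
    using (∨-comm; ∧-comm; ∧-absorbs-∨)

  infix 4 _≤_
  _≤_ : 𝕀 → 𝕀 → Set
  i ≤ j = i ∧ j ≡ i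

  ≤-refl : ∀ i → i ≤ i
  ≤-refl i = trans (cong (i ∧_) (sym (∨-identityʳ i))) (∧-absorbs-∨ i 0ᴵ)

  0≤ : ∀ i → 0ᴵ ≤ i
  0≤ i = trans (cong (0ᴵ ∧_) (sym (trans (∨-comm 0ᴵ i) (∨-identityʳ i)))) (∧-absorbs-∨ 0ᴵ i)

  ≤1 : ∀ i → i ≤ 1ᴵ
  ≤1 = ∧-identityʳ

module SimplicialTypeTheory (H : HoTT) (I : Interval) where
  open HoTT H
  open Interval I

  ----------------------------------------------------------------------
  -- Disjunction.  The join P ← P × Q → Q of two propositions is the
  -- propositional truncation of their sum: it is a proposition (or-isProp)
  -- and has the two injections and recursion.  In this form, a map out of
  -- P or Q into any type is a pair of maps which agree on P × Q.

  infixr 3 _or_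
  _or_ : Set a → Set b → Set (a ⊔ b)
  P or Q = Pushout {C = P × Q} proj₁ proj₂

  or-isProp : {P : Set a} {Q : Set b} → Irrelevant P → Irrelevant Q → Irrelevant (P or Q)
  or-isProp {P = P} {Q} P-prop Q-prop x y =
    trans (sym (proj₂ (contr x) x)) (proj₂ (contr x) y)
    where
    isContr-isProp : {A : Set ℓ} → Irrelevant (isContr A)
    isContr-isProp {A = A} (x₀ , h) (x₁ , k) = go (h x₁) h k
      where
      A-set : {u v : A} (p q : u ≡ v) → p ≡ q
      A-set p q = trans (canonical p) (sym (canonical q))
        where
        canonical : ∀ {u v} (p : u ≡ v) → p ≡ trans (sym (h u)) (h v)
        canonical {u} refl = sym (trans-symˡ (h u))
      go : ∀ {x₁} → x₀ ≡ x₁ → (h : ∀ y → x₀ ≡ y) (k : ∀ y → x₁ ≡ y) → (x₀ , h) ≡ (x₁ , k)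
      go refl h k = cong (x₀ ,_) (funext λ y → A-set (h y) (k y))

    inl-contr : P → isContr (P or Q)
    inl-contr p = inl p , elim (inl p ≡_)
      ((λ p′ → cong inl (P-prop p p′)) , (λ q → glue (p , q)) , λ (p′ , q) → coh (P-prop p p′) q)
      where
      coh : ∀ {p′} (e : p ≡ p′) q → subst (inl p ≡_) (glue (p′ , q)) (cong inl e) ≡ glue (p , q)
      coh refl q = subst-≡ (glue (p , q))
        where
        subst-≡ : ∀ {u v : P or Q} (e : u ≡ v) → subst (u ≡_) e refl ≡ e
        subst-≡ refl = refl

    inr-contr : Q → isContr (P or Q)
    inr-contr q = inr q , elim (inr q ≡_)
      ((λ p → sym (glue (p , q))) , (λ q′ → cong inr (Q-prop q q′)) , λ (p , q′) → coh p (Q-prop q q′))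
      where
      coh : ∀ p {q′} (e : q ≡ q′) → subst (inr q ≡_) (glue (p , q′)) (sym (glue (p , q))) ≡ cong inr e
      coh p refl = subst-sym (glue (p , q))
        where
        subst-sym : ∀ {u v : P or Q} (e : u ≡ v) → subst (v ≡_) e (sym e) ≡ refl
        subst-sym refl = refl

    contr : P or Q → isContr (P or Q)
    contr = rec inl-contr inr-contr (λ _ → isContr-isProp _ _)

  ----------------------------------------------------------------------
  -- Simplicial types

  isSimplicial : Set a → Set a
  isSimplicial A = ∀ i j → isEquiv (λ (x : A) (_ : (i ≤ j) or (j ≤ i)) → x)

  𝓤Simp : ∀ ℓ → Set (lsuc ℓ)
  𝓤Simp ℓ = Σ (Set ℓ) isSimplicial

  El : 𝓤Simp ℓ → Set ℓ
  El = proj₁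

  ----------------------------------------------------------------------
  -- Shapes

  Δ² : Set
  Δ² = Σ[ (i , j) ∈ 𝕀 × 𝕀 ] j ≤ i

  Λ²₀ Λ²₁ Λ²₂ : Set
  Λ²₀ = Σ[ ((i , j) , _) ∈ Δ² ] (i ≡ j or j ≡ 0ᴵ)
  Λ²₁ = Σ[ ((i , j) , _) ∈ Δ² ] (i ≡ 1ᴵ or j ≡ 0ᴵ)
  Λ²₂ = Σ[ ((i , j) , _) ∈ Δ² ] (i ≡ 1ᴵ or i ≡ j)

  ι₀ : Λ²₀ → Δ²
  ι₀ = proj₁

  ι₁ : Λ²₁ → Δ²
  ι₁ = proj₁

  ι₂ : Λ²₂ → Δ²
  ι₂ = proj₁

  -- The edge of Δ² from the vertex m to the vertex n.
  edge₀₁ edge₁₂ edge₀₂ : 𝕀 → Δ²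
  edge₀₁ i = (i , 0ᴵ) , 0≤ i
  edge₁₂ j = (1ᴵ , j) , ≤1 j
  edge₀₂ i = (i , i) , ≤-refl i

  edge₀₁-Λ²₀ : 𝕀 → Λ²₀
  edge₀₁-Λ²₀ i = edge₀₁ i , inr refl

  -- 𝕀≅ = Δ² ⊔_{Λ²₂} 𝕀 ⊔_{Λ²₀} Δ² is the free arrow with a section and a
  -- retraction: the arrow 𝕀 is the edge 1 → 2 of the first triangle and the
  -- edge 0 → 1 of the second, and both edges 0 → 2 are collapsed, to the
  -- target and to the source of the arrow respectively.
  collapse₂ : Λ²₂ → 𝕀
  collapse₂ (((i , j) , _) , o) =
    rec (λ (_ : i ≡ 1ᴵ) → j) (λ (_ : i ≡ j) → 1ᴵ) (λ (i≡1 , i≡j) → trans (sym i≡j) i≡1) o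

  collapse₀ : Λ²₀ → 𝕀
  collapse₀ (((i , j) , _) , o) =
    rec (λ (_ : i ≡ j) → 0ᴵ) (λ (_ : j ≡ 0ᴵ) → i) (λ (i≡j , j≡0) → sym (trans i≡j j≡0)) o

  𝕀≅ : Set
  𝕀≅ = Pushout {A = Pushout ι₂ collapse₂} (inr ∘ collapse₀) ι₀

  ----------------------------------------------------------------------
  -- Orthogonality

  Pullback : {B : Set b} {C : Set c} {D : Set d} → (B → D) → (C → D) → Set (b ⊔ c ⊔ d)
  Pullback {B = B} {C} f g = Σ[ x ∈ B ] Σ[ y ∈ C ] f x ≡ g y

  module _ {X : Set a} (A : X → Set b) {K : Set c} {L : Set d} (j : K → L) where

    Gap : Set (a ⊔ b ⊔ c ⊔ d)
    Gap = Pullback {B = L → X} {C = K → Σ X A} (_∘ j) (proj₁ ∘_)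

    gap : (L → Σ X A) → Gap
    gap f = proj₁ ∘ f , f ∘ j , refl

    isRightOrthogonal : Set (a ⊔ b ⊔ c ⊔ d)
    isRightOrthogonal = isEquiv gap

  module _ {X : Set a} (A : X → Set b) where

    isInner : Set (a ⊔ b)
    isInner = isRightOrthogonal A ι₁

    isIsoInner : Set (a ⊔ b)
    isIsoInner = isInner × isRightOrthogonal A {K = 𝕀≅} {L = ⊤} _

  ----------------------------------------------------------------------
  -- Cocartesian arrows and families

  -- A map Φ : E → P over B, where E is a family over B via r ∘ Φ.
  onFibers : {E : Set a} {P : Set b} {B : Set c} (Φ : E → P) (r : P → B) (y : B) →
             fiber (r ∘ Φ) y → fiber r y
  onFibers Φ r y (t , e) = Φ t , e

  module _ {X : Set a} (A : X → Set b) where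

    restrict₀₁ : Gap A ι₀ → (𝕀 → Σ X A)
    restrict₀₁ (_ , h , _) = h ∘ edge₀₁-Λ²₀

    isCocartesianArrow : (𝕀 → Σ X A) → Set (a ⊔ b)
    isCocartesianArrow f = isEquiv (onFibers (gap A ι₀) restrict₀₁ f)

    total : (u : 𝕀 → X) → (∀ i → A (u i)) → (𝕀 → Σ X A)
    total u x i = u i , x i

    isCocartesianFamily : Set (a ⊔ b)
    isCocartesianFamily =
        isIsoInner A
      × (∀ x → isSimplicial (A x))
      × (∀ (u : 𝕀 → X) (x₀ : A (u 0ᴵ)) →
           Σ[ x ∈ (∀ i → A (u i)) ] x 0ᴵ ≡ x₀ × isCocartesianArrow (total u x))

  ----------------------------------------------------------------------
  -- Locally cocartesian arrows

  module _ (A : 𝕀 → Set a) where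

    -- The map [x , y , p], equal to x on the edge 0 → 1 and to y on the edge
    -- 0 → 2, glued along p at the vertex 0.
    copair : (x y : ∀ i → A i) → x 0ᴵ ≡ y 0ᴵ →
             (s : Λ²₀) → A (proj₁ (proj₁ (ι₀ s)))
    copair x y p (((i , j) , _) , o) =
      rec (λ (_ : i ≡ j) → y i) (λ (_ : j ≡ 0ᴵ) → x i)
          (λ (i≡j , j≡0) → subst (λ k → y k ≡ x k) (sym (trans i≡j j≡0)) (sym p)) o

    isLCC : (∀ i → A i) → Set a
    isLCC x = (y : ∀ i → A i) (p : x 0ᴵ ≡ y 0ᴵ) →
      isContr (Σ[ t ∈ ((s : Δ²) → A (proj₁ (proj₁ s))) ] (λ s → t (ι₀ s)) ≡ copair x y p)

    hasLCCLifts-𝕀 : Set a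
    hasLCCLifts-𝕀 = (x₀ : A 0ᴵ) → Σ[ x ∈ (∀ i → A i) ] x 0ᴵ ≡ x₀ × isLCC x

  LCCLiftsCompose-Δ² : (Δ² → Set a) → Set a
  LCCLiftsCompose-Δ² A = (x : ∀ s → A s) →
    isLCC (A ∘ edge₀₁) (x ∘ edge₀₁) → isLCC (A ∘ edge₁₂) (x ∘ edge₁₂) →
    isLCC (A ∘ edge₀₂) (x ∘ edge₀₂)

  module _ {X : Set a} (A : X → Set b) where

    hasLCCLifts : Set (a ⊔ b)
    hasLCCLifts = (u : 𝕀 → X) → hasLCCLifts-𝕀 (A ∘ u)

    LCCLiftsCompose : Set (a ⊔ b)
    LCCLiftsCompose = (h : 𝕀 × 𝕀 → X) → LCCLiftsCompose-Δ² (A ∘ h ∘ proj₁)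

{-# OPTIONS --without-K #-}
-- For arrows over composable edges of X, write x ⨾ - for precomposition with x.
-- That x is locally cocartesian means that x ⨾ - is an equivalence on vertical
-- arrows, and that x is cocartesian means that it is an equivalence on arrows
-- over every v : 𝕀 → X.  Given x and v, let z be a locally cocartesian lift of v
-- starting at the target of x.  Then z and x ⨾ z are locally cocartesian, so
-- that z ⨾ - and (x ⨾ z) ⨾ - are equivalences on vertical arrows.  By
-- associativity (x ⨾ z) ⨾ - is z ⨾ - followed by x ⨾ -, hence x ⨾ - is an
-- equivalence.  Associativity takes the form of two inner extension properties
-- of Δ³ = {i ≥ j ≥ k}: a section over it amounts to a section over the faces
-- i = 1 and j = k, which for fixed k form an inner horn with vertex (1, k), and
-- to a section over the faces j = i and k = 0, which do so for fixed i.
module Submission where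

import Algebra.Lattice.Structures as Lattice
open import Algebra.Lattice.Bundles using () renaming (Lattice to LatticeBundle)
import Algebra.Lattice.Properties.Lattice as LatticeProperties
import Relation.Binary.Lattice as Order
import Relation.Binary.Lattice.Properties.JoinSemilattice as JoinSemilattice
import Relation.Binary.Lattice.Properties.MeetSemilattice as MeetSemilattice
open import Level using (Level; _⊔_)
open import Data.Product using (Σ; Σ-syntax; _×_; _,_; proj₁; proj₂)
open import Data.Unit using (⊤; tt)
open import Function using (_∘_; id)
open import Relation.Binary.PropositionalEquality
open import Relation.Nullary using (Irrelevant)
open import Defs

private variable
  a b c d ℓ ℓ′ : Level

-- Contractibility, fibers and equivalences.

isContr⇒≡ : {A : Set a} → isContr A → (x y : A) → x ≡ y
isContr⇒≡ (_ , h) x y = trans (sym (h x)) (h y)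

isContr-retract : {A : Set a} {B : Set b} (s : A → B) (r : B → A) →
                  (∀ x → r (s x) ≡ x) → isContr B → isContr A
isContr-retract s r rs (y , h) = r y , λ x → trans (cong r (h (s x))) (rs x)

isContr-Σ : {A : Set a} {B : A → Set b} → isContr A → (∀ x → isContr (B x)) → isContr (Σ A B)
isContr-Σ {A = A} {B} (x₀ , h) k = (x₀ , proj₁ (k x₀)) , λ (x , y) → go (h x) y
  where
  go : ∀ {x} → x₀ ≡ x → (y : B x) → (x₀ , proj₁ (k x₀)) ≡ (x , y)
  go refl y = cong (x₀ ,_) (proj₂ (k x₀) y)

module _ {A : Set a} {B : Set b} {f : A → B} (f-equiv : isEquiv f) where

  inv : B → A
  inv y = proj₁ (proj₁ (f-equiv y))

  f∘inv : ∀ y → f (inv y) ≡ y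
  f∘inv y = proj₂ (proj₁ (f-equiv y))

  inv∘f : ∀ x → inv (f x) ≡ x
  inv∘f x = cong proj₁ (proj₂ (f-equiv (f x)) (x , refl))

-- `fiber f y` is a retract of the singleton at `g y`. The way back composes
-- `cong f (trans (η x) q)` with `ε` on both sides, so that everything cancels without a coherence
-- between `η` and `ε`.
quasiInverse : {A : Set a} {B : Set b} (f : A → B) (g : B → A) →
               (∀ x → g (f x) ≡ x) → (∀ y → f (g y) ≡ y) → isEquiv f
quasiInverse {A = A} f g η ε y =
  isContr-retract (λ (x , p) → x , trans (sym (η x)) (cong g p))
    (λ (x , q) → x , trans (sym (ε (f x))) (trans (cong f (trans (η x) q)) (ε y)))
    (λ { (x , refl) → cong (x ,_) (trans
      (cong (λ p → trans (sym (ε (f x))) (trans (cong f p) (ε (f x)))) (cancel (η x)))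
      (trans-symˡ (ε (f x)))) })
    ((g y , refl) , λ { (_ , refl) → refl })
  where
  cancel : ∀ {x x′ : A} (p : x ≡ x′) → trans p (trans (sym p) refl) ≡ refl
  cancel refl = refl

module _ {A : Set a} {B : Set b} {C : Set c} {F : A → B} {G : B → C} where

  -- Contractibility is required only over points that `G` sends to `z`: in the application it comes
  -- from an edge, fixed by `z`, being locally cocartesian.
  fiber-cancelʳ : ∀ {z} → (∀ y → G y ≡ z → isContr (fiber F y)) →
                  isContr (fiber (G ∘ F) z) → isContr (fiber G z)
  fiber-cancelʳ {z} F-contr = isContr-retract
    (λ (y , e) → let ((x , q) , _) = F-contr y e in x , trans (cong G q) e)
    (λ (x , e) → F x , e)
    (λ (y , e) → go (proj₂ (proj₁ (F-contr y e))) e)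
    where
    go : ∀ {y y′} (q : y′ ≡ y) (e : G y ≡ z) → (y′ , trans (cong G q) e) ≡ (y , e)
    go refl e = refl

  fiber-∘ : ∀ {z} → (∀ y → G y ≡ z → isContr (fiber F y)) →
            isContr (fiber G z) → isContr (fiber (G ∘ F) z)
  fiber-∘ {z} F-contr G-contr = isContr-retract
    (λ (x , e) → (F x , e) , (x , refl))
    (λ ((y , e) , (x , q)) → x , trans (cong G q) e)
    (λ _ → refl)
    (isContr-Σ {B = λ (y , _) → fiber F y} G-contr (λ (y , e) → F-contr y e))

  fiber-cancelˡ : isEquiv G → ∀ {y} → isContr (fiber (G ∘ F) (G y)) → isContr (fiber F y)
  fiber-cancelˡ G-equiv {y} = isContr-retract
    (λ (x , p) → x , cong G p)
    (λ (x , p) → x , cong proj₁ (isContr⇒≡ (G-equiv (G y)) (F x , p) (y , refl)))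
    (λ { (x , refl) → cong (λ p → x , cong proj₁ p) (trans-symˡ (proj₂ (G-equiv _) _)) })

  isEquiv-∘ : isEquiv F → isEquiv G → isEquiv (G ∘ F)
  isEquiv-∘ F-equiv G-equiv z = fiber-∘ (λ y _ → F-equiv y) (G-equiv z)

exchange : {A : Set a} {B : Set b} {C : A → B → Set c} →
           (Σ[ x ∈ A ] Σ[ y ∈ B ] C x y) → Σ[ y ∈ B ] Σ[ x ∈ A ] C x y
exchange (x , y , z) = y , x , z

exchange-isEquiv : {A : Set a} {B : Set b} {C : A → B → Set c} → isEquiv (exchange {C = C})
exchange-isEquiv = quasiInverse exchange exchange (λ _ → refl) (λ _ → refl)

isEquiv-total : {A : Set a} {B : Set b} {P : A → Set c} {Q : B → Set d} {f : A → B}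
                {g : ∀ x → P x → Q (f x)} → isEquiv f → (∀ x → isEquiv (g x)) →
                isEquiv {A = Σ A P} {B = Σ B Q} (λ (x , p) → f x , g x p)
isEquiv-total {P = P} {Q} {f} {g} f-equiv g-equiv (y , q) =
  isContr-retract to (λ ((x , e) , (p , r)) → from e r) (λ { (_ , refl) → refl })
    (isContr-Σ (f-equiv y) λ (x , e) → g-equiv x (subst Q (sym e) q))
  where
  to : fiber (λ (x , p) → f x , g x p) (y , q) →
       Σ[ (x , e) ∈ fiber f y ] fiber (g x) (subst Q (sym e) q)
  to ((x , p) , refl) = (x , refl) , (p , refl)
  from : ∀ {y q x p} (e : f x ≡ y) → g x p ≡ subst Q (sym e) q →
         fiber (λ (x , p) → f x , g x p) (y , q)
  from {x = x} {p} refl r = (x , p) , cong (f x ,_) r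

isEquiv-precompose : {K : Set a} {M : Set b} {D : M → Set c} {m : K → M} → isEquiv m →
                     HoTT → isEquiv (λ (f : ∀ x → D x) k → f (m k))
isEquiv-precompose {D = D} {m} m-equiv H = quasiInverse _
  (λ g x → transport (proj₁ (m-equiv x)) g)
  (λ f → funext λ x → dcong f (f∘inv m-equiv x))
  (λ g → funext λ k → cong (λ w → transport w g) (proj₂ (m-equiv (m k)) (k , refl)))
  where
  open HoTT H using (funext)
  transport : ∀ {x} → fiber m x → (∀ k → D (m k)) → D x
  transport (k , e) g = subst D e (g k)

module _ {T : Set a} {E : Set b} {C : E → Set c} {D : Set d} (f : T → Σ E C) (g : D → E) where

  -- The pullback of `f` along `(y , w) ↦ (g y , w)`, with the equation in `Σ E C` reduced to its
  -- first component. Hence its fibers are fibers of `f`.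
  basechange : (Σ[ y ∈ D ] Σ[ x ∈ T ] proj₁ (f x) ≡ g y) → Σ D (C ∘ g)
  basechange (y , x , e) = y , subst C e (proj₂ (f x))

  private
    split : ∀ {p : Σ E C} {x w} → p ≡ (x , w) → Σ[ e ∈ proj₁ p ≡ x ] subst C e (proj₂ p) ≡ w
    split refl = refl , refl

    pair : ∀ {p : Σ E C} {x w} → Σ[ e ∈ proj₁ p ≡ x ] subst C e (proj₂ p) ≡ w → p ≡ (x , w)
    pair (refl , refl) = refl

    pair∘split : ∀ {p : Σ E C} {x w} (e : p ≡ (x , w)) → pair (split e) ≡ e
    pair∘split refl = refl

    split∘pair : ∀ {p : Σ E C} {x} (e : proj₁ p ≡ x) → split {p} (pair (e , refl)) ≡ (e , refl)
    split∘pair refl = refl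

    to : ∀ {y w} → fiber basechange (y , w) → fiber f (g y , w)
    to ((y , x , e) , refl) = x , pair (e , refl)

    from : ∀ {y w} → fiber f (g y , w) → fiber basechange (y , w)
    from {y} (x , p) = (y , x , proj₁ (split p)) , cong (y ,_) (proj₂ (split p))

    from∘to : ∀ {y w} (z : fiber basechange (y , w)) → from (to z) ≡ z
    from∘to ((y , x , e) , refl) = cong (λ (e , q) → (y , x , e) , cong (y ,_) q) (split∘pair e)

    to∘from : ∀ {y w} (z : fiber f (g y , w)) → to (from z) ≡ z
    to∘from {y} (x , p) = trans (go (split p)) (cong (x ,_) (pair∘split p))
      where
      go : ∀ {w} (s : Σ[ e ∈ proj₁ (f x) ≡ g y ] subst C e (proj₂ (f x)) ≡ w) →
           to ((y , x , proj₁ s) , cong (y ,_) (proj₂ s)) ≡ (x , pair s)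
      go (e , refl) = refl

  fiber-basechange : ∀ {y w} → isContr (fiber f (g y , w)) → isContr (fiber basechange (y , w))
  fiber-basechange = isContr-retract to from from∘to

  fiber-basechange⁻ : ∀ {y w} → isContr (fiber basechange (y , w)) → isContr (fiber f (g y , w))
  fiber-basechange⁻ = isContr-retract from to to∘from

sym-involutive : {A : Set a} {x y : A} (p : x ≡ y) → sym (sym p) ≡ p
sym-involutive refl = refl

trans-sym-isEquiv : {A : Set a} {x y z : A} (p : x ≡ y) → isEquiv (λ (q : z ≡ y) → trans p (sym q))
trans-sym-isEquiv refl = quasiInverse _ sym sym-involutive sym-involutive

trans-isEquiv : {A : Set a} {x y z : A} (p : x ≡ y) → isEquiv (λ (q : y ≡ z) → trans p q)
trans-isEquiv refl = id-isEquiv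

-- Function extensionality as an equivalence.

module Funext (H : HoTT) where
  open HoTT H using (funext)

  module _ {A : Set a} {B : A → Set b} {f : ∀ x → B x} where

    isContr-homotopies : isContr (Σ[ g ∈ (∀ x → B x) ] ∀ x → f x ≡ g x)
    isContr-homotopies = isContr-retract (λ (g , h) x → g x , h x)
      (λ k → proj₁ ∘ k , proj₂ ∘ k) (λ _ → refl)
      ((λ x → f x , refl) , λ k → funext λ x → go (proj₂ (k x)))
      where
      go : ∀ {x} {y : B x} (p : f x ≡ y) → (f x , refl) ≡ (y , p)
      go refl = refl

    homotopy-induction : (P : (g : ∀ x → B x) → (∀ x → f x ≡ g x) → Set ℓ) →
                         P f (λ _ → refl) → ∀ {g} h → P g h
    homotopy-induction P p {g} h =
      subst (λ (g , h) → P g h) (isContr⇒≡ isContr-homotopies (f , λ _ → refl) (g , h)) p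

    -- Unlike funext, this is by construction inverse to cong-app.
    fromHomotopy : {g : ∀ x → B x} → (∀ x → f x ≡ g x) → f ≡ g
    fromHomotopy h = cong proj₁ (isContr⇒≡ isContr-homotopies (f , λ _ → refl) (_ , h))

    fromHomotopy-refl : fromHomotopy (λ x → refl) ≡ refl
    fromHomotopy-refl = cong (cong proj₁) (trans-symˡ (proj₂ isContr-homotopies _))

    fromHomotopy-isEquiv : {g : ∀ x → B x} → isEquiv (fromHomotopy {g})
    fromHomotopy-isEquiv = quasiInverse fromHomotopy cong-app
      (homotopy-induction (λ g h → cong-app (fromHomotopy h) ≡ h) (cong cong-app fromHomotopy-refl))
      (λ { refl → fromHomotopy-refl })

-- Sections over unions, and transfer of unique extension.

module Sections (H : HoTT) where
  open HoTT H
  open Funext H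

  module _ {P : Set a} {Q : Set b} {W : Set c} {f : W → P} {g : W → Q} {Y : Set ℓ}
           (l : P → Y) (r : Q → Y) (h : ∀ z → l (f z) ≡ r (g z)) where

    rec-inl : ∀ x → rec {f = f} {g} l r h (inl x) ≡ l x
    rec-inl x = elim-inl _ _ x

    rec-inr : ∀ x → rec {f = f} {g} l r h (inr x) ≡ r x
    rec-inr x = elim-inr _ _ x

    private
      Const : Pushout f g → Set ℓ
      Const _ = Y

      method : {m : Method {f = f} {g} Const} (k : Pushout f g → Y) → k ≡ elim Const m →
               Method {f = f} {g} Const
      method {m} _ _ = m

      subst-const : ∀ {A : Set ℓ′} {v w : A} (p : v ≡ w) {y : Y} → subst (λ _ → Y) p y ≡ y
      subst-const refl = refl

      -- The definition of rec uses a local function which cannot be named here;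
      -- replacing glue z by refl shows that it agrees with subst-const.
      method-glue : ∀ z → proj₂ (proj₂ (method (rec {f = f} {g} l r h) refl)) z ≡
                          trans (subst-const (glue z)) (h z)
      method-glue z with inr {f = f} {g} (g z) | glue {f = f} {g} z
      ... | _ | refl = refl

    rec-glue : ∀ z → trans (cong (rec {f = f} {g} l r h) (glue z)) (rec-inr (g z)) ≡
                     trans (rec-inl (f z)) (h z)
    rec-glue z = go (glue z) (rec {f = f} {g} l r h) (rec-inr (g z)) (rec-inl (f z)) (h z)
      (trans (elim-glue Const _ z) (cong (trans (cong (subst Const (glue z)) (rec-inl (f z)))) (method-glue z)))
      where
      go : ∀ {A : Set (a ⊔ b ⊔ c)} {v w : A} (e : v ≡ w) (k : A → Y) {y₁ y₂}
           (p : k w ≡ y₂) (q : k v ≡ y₁) (s : y₁ ≡ y₂) →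
           trans (dcong k e) p ≡ trans (cong (subst (λ _ → Y) e) q) (trans (subst-const e) s) →
           trans (cong k e) p ≡ trans q s
      go refl k refl refl s t = t

  module _ {P : Set a} {Q : Set b} {Y : Set ℓ} where

    Matching : Set (a ⊔ b ⊔ ℓ)
    Matching = Σ[ f ∈ (P → Y) ] Σ[ g ∈ (Q → Y) ] ∀ z → f (proj₁ z) ≡ g (proj₂ z)

    or-split : (Pushout {A = P} {B = Q} {C = P × Q} proj₁ proj₂ → Y) → Matching
    or-split k = k ∘ inl , k ∘ inr , λ z → cong k (glue z)

    Matching-≡ : ∀ {m n : Matching} (p : ∀ x → proj₁ m x ≡ proj₁ n x)
                 (q : ∀ x → proj₁ (proj₂ m) x ≡ proj₁ (proj₂ n) x) →
                 (∀ z → trans (proj₂ (proj₂ m) z) (q (proj₂ z)) ≡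
                        trans (p (proj₁ z)) (proj₂ (proj₂ n) z)) → m ≡ n
    Matching-≡ {f , g , h} {f′ , g′ , h′} p q =
      homotopy-induction
        (λ f′ p → ∀ h′ → (∀ z → trans (h z) (q (proj₂ z)) ≡ trans (p (proj₁ z)) (h′ z)) →
                  (f , g , h) ≡ (f′ , g′ , h′))
        (homotopy-induction
          (λ g′ q → ∀ h′ → (∀ z → trans (h z) (q (proj₂ z)) ≡ h′ z) → (f , g , h) ≡ (f , g′ , h′))
          (λ h′ s → cong (λ h → f , g , h) (funext λ z → trans (sym (trans-reflʳ (h z))) (s z)))
          q)
        p h′

    -- The universal property of the join. Uniqueness is checked by `elim` on `inl`, on `inr` and
    -- along `glue`, where `rec-glue` supplies the path.
    or-split-isEquiv : isEquiv or-split
    or-split-isEquiv = quasiInverse or-split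
      (λ (f , g , h) → rec f g h)
      (λ k → funext (elim _
        ( rec-inl (k ∘ inl) (k ∘ inr) (λ z → cong k (glue z))
        , rec-inr (k ∘ inl) (k ∘ inr) (λ z → cong k (glue z))
        , λ z → subst-≡-homotopy (glue z) _ _ (rec-glue (k ∘ inl) (k ∘ inr) (λ z → cong k (glue z)) z))))
      (λ (f , g , h) → Matching-≡ (rec-inl f g h) (rec-inr f g h) (rec-glue f g h))
      where
      subst-≡-homotopy : ∀ {A : Set ℓ′} {k k′ : A → Y} {v w : A} (e : v ≡ w)
                         (p : k v ≡ k′ v) (q : k w ≡ k′ w) →
                         trans (cong k e) q ≡ trans p (cong k′ e) → subst (λ w → k w ≡ k′ w) e p ≡ q
      subst-≡-homotopy refl p q s = sym (trans s (trans-reflʳ p))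

  restrict : {L : Set a} (C : L → Set b) (φ : L → Set c) →
             (∀ x → C x) → ∀ (m : Σ L φ) → C (proj₁ m)
  restrict C φ t m = t (proj₁ m)

  ∏-isEquiv : {K : Set a} {C : K → Set b} {D : K → Set c} {f : ∀ k → C k → D k} →
              (∀ k → isEquiv (f k)) → isEquiv (λ (t : ∀ k → C k) k → f k (t k))
  ∏-isEquiv f-equiv = quasiInverse _ (λ t k → inv (f-equiv k) (t k))
    (λ t → funext λ k → inv∘f (f-equiv k) (t k))
    (λ t → funext λ k → f∘inv (f-equiv k) (t k))

  module _ {L : Set a} (C : L → Set b) (P Q : L → Set) where

    private
      _∪_ : (L → Set) → (L → Set) → L → Set
      (P ∪ Q) x = Pushout {A = P x} {B = Q x} {C = P x × Q x} proj₁ proj₂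

    module _ {K₁ K₂ K₃ : Set}
             {m₁ : K₁ → Σ L P} (m₁-equiv : isEquiv m₁)
             {m₂ : K₂ → Σ L Q} (m₂-equiv : isEquiv m₂)
             {m₃ : K₃ → Σ[ x ∈ L ] P x × Q x} (m₃-equiv : isEquiv m₃)
             (R : (∀ k → C (proj₁ (m₁ k))) → (∀ k → C (proj₁ (m₂ k))) → Set ℓ)
             (join : (f : ∀ (m : Σ L P) → C (proj₁ m)) (g : ∀ (m : Σ L Q) → C (proj₁ m)) →
                     (∀ k → f (proj₁ (m₃ k) , proj₁ (proj₂ (m₃ k))) ≡
                            g (proj₁ (m₃ k) , proj₂ (proj₂ (m₃ k)))) →
                     R (f ∘ m₁) (g ∘ m₂))
             (join-equiv : ∀ f g → isEquiv (join f g))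
             where

      -- The maps `m₁`, `m₂`, `m₃` parametrize the two parts and their intersection, and `R` is the
      -- desired form of agreement on the latter: an equation at a vertex for horns, an equality of
      -- edges for the faces of `Δ³`.
      split : (∀ (m : Σ L (P ∪ Q)) → C (proj₁ m)) →
              Σ[ f ∈ (∀ k → C (proj₁ (m₁ k))) ] Σ[ g ∈ (∀ k → C (proj₁ (m₂ k))) ] R f g
      split t = (λ k → let (x , p) = m₁ k in t (x , inl p))
              , (λ k → let (x , q) = m₂ k in t (x , inr q))
              , join (λ (x , p) → t (x , inl p)) (λ (x , q) → t (x , inr q))
                  (λ k → let (x , p , q) = m₃ k in cong (λ o → t (x , o)) (glue (p , q)))

      split-isEquiv : isEquiv split
      split-isEquiv = isEquiv-∘ separate-isEquiv (isEquiv-total (isEquiv-precompose m₁-equiv H) λ f →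
        isEquiv-total (isEquiv-precompose m₂-equiv H) λ g →
        isEquiv-∘ (isEquiv-precompose m₃-equiv H) (join-equiv f g))
        where
        Separate : Set _
        Separate = Σ[ f ∈ (∀ (m : Σ L P) → C (proj₁ m)) ] Σ[ g ∈ (∀ (m : Σ L Q) → C (proj₁ m)) ]
                   (∀ (m : Σ[ x ∈ L ] P x × Q x) →
                    let (x , p , q) = m in f (x , p) ≡ g (x , q))
        separate : (∀ (m : Σ L (P ∪ Q)) → C (proj₁ m)) → Separate
        separate t = (λ (x , p) → t (x , inl p)) , (λ (x , q) → t (x , inr q))
                   , λ (x , p , q) → cong (λ o → t (x , o)) (glue (p , q))
        pointwise : isEquiv (λ (t : ∀ x → (P ∪ Q) x → C x) x → or-split (t x))
        pointwise = ∏-isEquiv (λ _ → or-split-isEquiv)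
        collect : (∀ x → Matching {P = P x} {Q x} {C x}) → Separate
        collect m = (λ (x , p) → proj₁ (m x) p) , (λ (x , q) → proj₁ (proj₂ (m x)) q)
                  , λ (x , z) → proj₂ (proj₂ (m x)) z
        separate-isEquiv : isEquiv separate
        separate-isEquiv = quasiInverse separate
          (λ (f , g , h) (x , o) →
            inv pointwise (λ x → (λ p → f (x , p)) , (λ q → g (x , q)) , λ z → h (x , z)) x o)
          (λ t → cong (λ t (x , o) → t x o) (inv∘f pointwise (λ x o → t (x , o))))
          (λ (f , g , h) → cong collect
            (f∘inv pointwise (λ x → (λ p → f (x , p)) , (λ q → g (x , q)) , λ z → h (x , z))))

  -- Fillers over L give fillers over L′ by composition with r and s, although s
  -- need not map φ′ into φ.  For x ∈ φ′, the simplex r ∘ q x lies in φ′, so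
  -- that both the filler and the given section restrict to it; the results
  -- agree on φ, hence everywhere, and in particular at s x, a fixed point of
  -- q x.
  module Slice {X : Set a} (A : X → Set b) {L L′ : Set} {φ : L → Set} {φ′ : L′ → Set}
               (φ′-prop : ∀ x → Irrelevant (φ′ x))
               (r : L → L′) (s : L′ → L) (rs : ∀ x → r (s x) ≡ x)
               (r-φ : ∀ y → φ y → φ′ (r y))
               (q : L′ → L → L) (q-s : ∀ x → q x (s x) ≡ s x)
               (q-φ : ∀ x y → φ y → φ (q x y))
               (q-φ′ : ∀ x y → φ′ x → φ′ (r (q x y)))
               (orth : (σ : L → X) → isEquiv (restrict (A ∘ σ) φ))
               (τ : L′ → X)
               where

    private
      Section : Set b
      Section = (m : Σ L′ φ′) → A (τ (proj₁ m))

      filler : Section → ∀ y → A (τ (r y))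
      filler g = inv (orth (τ ∘ r)) (λ (y , p) → g (r y , r-φ y p))

      filler-φ : ∀ g y (p : φ y) → filler g y ≡ g (r y , r-φ y p)
      filler-φ g y p = cong-app (f∘inv (orth (τ ∘ r)) (λ (y , p) → g (r y , r-φ y p))) (y , p)

      extend : Section → ∀ x → A (τ x)
      extend g x = subst (A ∘ τ) (rs x) (filler g (s x))

      independent : ∀ (g : Section) {x x′} (e : x′ ≡ x) (p : φ′ x) (p′ : φ′ x′) →
                    subst (A ∘ τ) e (g (x′ , p′)) ≡ g (x , p)
      independent g refl p p′ = cong (λ p → g (_ , p)) (φ′-prop _ p′ p)

      filler-q : ∀ g x (p : φ′ x) → filler g ∘ q x ≡ λ y → g (r (q x y) , q-φ′ x y p)
      filler-q g x p =
        trans (sym (inv∘f (orth (τ ∘ r ∘ q x)) _))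
          (trans (cong (inv (orth (τ ∘ r ∘ q x))) (funext λ (y , o) →
                   trans (filler-φ g (q x y) (q-φ x y o)) (independent g refl _ _)))
                 (inv∘f (orth (τ ∘ r ∘ q x)) _))

      extend-restrict : ∀ g x (p : φ′ x) → extend g x ≡ g (x , p)
      extend-restrict g x p = go (q-s x) (q-φ′ x (s x) p) (cong-app (filler-q g x p) (s x))
        where
        go : ∀ {y} → y ≡ s x → (p′ : φ′ (r y)) → filler g y ≡ g (r y , p′) → extend g x ≡ g (x , p)
        go refl p′ e = trans (cong (subst (A ∘ τ) (rs x)) e) (independent g (rs x) p p′)

    slice : isEquiv (restrict (A ∘ τ) φ′)
    slice = quasiInverse _ extend
      -- The section `t ∘ r` fills its own restriction, so the filler is `t ∘ r` itself.
      (λ t → funext λ x →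
        trans (cong (subst (A ∘ τ) (rs x)) (cong-app (inv∘f (orth (τ ∘ r)) (t ∘ r)) (s x)))
              (dcong t (rs x)))
      (λ g → funext λ (x , p) → extend-restrict g x p)

-- Monotonicity and absorption in the interval.

module IntervalOrder (I : Interval) where
  open Interval I
  private
    module L = Lattice.IsDistributiveLattice isDistributiveLattice
    lattice : LatticeBundle _ _
    lattice = record { isLattice = L.isLattice }
    module O = Order.Lattice (LatticeProperties.∨-∧-orderTheoreticLattice lattice)
    module J = JoinSemilattice O.joinSemilattice
    module M = MeetSemilattice O.meetSemilattice

  open LatticeProperties lattice public using (∧-idem; ∨-idem)

  -- In the order of the standard library, i ≤ j is i ≡ i ∧ j.
  ∨-mono-≤ : ∀ {i j k l} → i ≤ j → k ≤ l → i ∨ k ≤ j ∨ l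
  ∨-mono-≤ p q = sym (J.∨-monotonic (sym p) (sym q))

  ∧-mono-≤ : ∀ {i j k l} → i ≤ j → k ≤ l → i ∧ k ≤ j ∧ l
  ∧-mono-≤ p q = sym (M.∧-monotonic (sym p) (sym q))

  ≤-trans : ∀ {i j k} → i ≤ j → j ≤ k → i ≤ k
  ≤-trans p q = sym (O.trans (sym p) (sym q))

  j≤i∨j : ∀ i j → j ≤ i ∨ j
  j≤i∨j i j = sym (O.y≤x∨y i j)

  i≤i∨j : ∀ i j → i ≤ i ∨ j
  i≤i∨j i j = sym (O.x≤x∨y i j)

  i∧j≤i : ∀ i j → i ∧ j ≤ i
  i∧j≤i i j = sym (O.x∧y≤x i j)

  i∧j≤j : ∀ i j → i ∧ j ≤ j
  i∧j≤j i j = sym (O.x∧y≤y i j)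

  i≤j⇒j∨i≡j : ∀ {i j} → i ≤ j → j ∨ i ≡ j
  i≤j⇒j∨i≡j {i} {j} p = trans (∨-comm j i) (J.x≤y⇒x∨y≈y (sym p))

  ∧≤∨ : ∀ {i j k l} → j ≤ i → j ∧ l ≤ i ∨ k
  ∧≤∨ {i} {j} {k} {l} p = ≤-trans (i∧j≤i j l) (≤-trans p (i≤i∨j i k))

  [i∧j]∨j≡j : ∀ i j → (i ∧ j) ∨ j ≡ j
  [i∧j]∨j≡j i j = J.x≤y⇒x∨y≈y (O.x∧y≤y i j)

  [i∨j]∧j≡j : ∀ i j → (i ∨ j) ∧ j ≡ j
  [i∨j]∧j≡j i j = M.y≤x⇒x∧y≈y (O.y≤x∨y i j)

  1∨i≡1 : ∀ i → 1ᴵ ∨ i ≡ 1ᴵ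
  1∨i≡1 i = i≤j⇒j∨i≡j (≤1 i)

  0∨i≡i : ∀ i → 0ᴵ ∨ i ≡ i
  0∨i≡i i = J.x≤y⇒x∨y≈y (sym (0≤ i))

  1∧i≡i : ∀ i → 1ᴵ ∧ i ≡ i
  1∧i≡i i = trans (∧-comm 1ᴵ i) (≤1 i)

-- Unique extension, triangles and horns.

module Fillers (H : HoTT) (I : Interval) where
  open HoTT H
  open Interval I
  open SimplicialTypeTheory H I
  open Funext H
  open Sections H
  open IntervalOrder I

  module _ {X : Set a} (A : X → Set b) {K : Set c} {L : Set d} (j : K → L) where

    private
      -- The equation `e` is kept general so that path induction applies to the fibers of `gap`; at
      -- `refl` this is the type of extensions of a section along `j`.
      Lift : Gap A j → Set (b ⊔ c ⊔ d)
      Lift (σ , g , e) =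
        Σ[ t ∈ (∀ x → A (σ x)) ] subst (λ u → ∀ k → A (u k)) e (t ∘ j) ≡ proj₂ ∘ g

      toLift : ∀ P → fiber (gap A j) P → Lift P
      toLift _ (f , refl) = proj₂ ∘ f , refl

      fromLift : ∀ {σ} {g₁ : K → X} (e : σ ∘ j ≡ g₁) {g₂ : ∀ k → A (g₁ k)} →
                 Lift (σ , (λ k → g₁ k , g₂ k) , e) →
                 fiber (gap A j) (σ , (λ k → g₁ k , g₂ k) , e)
      fromLift refl (t , refl) = (λ x → _ , t x) , refl

    extension-contr : ∀ σ (g : ∀ k → A (σ (j k))) →
                      isContr (fiber (gap A j) (σ , (λ k → σ (j k) , g k) , refl)) →
                      isContr (fiber (λ (t : ∀ x → A (σ x)) → t ∘ j) g)
    extension-contr σ g = isContr-retract (fromLift refl) (toLift _) (λ { (t , refl) → refl })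

    gap-contr : ∀ σ (g : ∀ k → A (σ (j k))) →
                isContr (fiber (λ (t : ∀ x → A (σ x)) → t ∘ j) g) →
                isContr (fiber (gap A j) (σ , (λ k → σ (j k) , g k) , refl))
    gap-contr σ g = isContr-retract (toLift _) (fromLift refl) (go _)
      where
      go : ∀ P (w : fiber (gap A j) P) → fromLift (proj₂ (proj₂ P)) (toLift P w) ≡ w
      go _ (f , refl) = refl

  Tri : (𝕀 × 𝕀 → Set ℓ) → Set ℓ
  Tri B = (s : Δ²) → B (proj₁ s)

  Δ²-≡ : ∀ {i i′ j j′} {p : j ≤ i} {p′ : j′ ≤ i′} → i ≡ i′ → j ≡ j′ →
         _≡_ {A = Δ²} ((i , j) , p) ((i′ , j′) , p′)
  Δ²-≡ refl refl = cong (_ ,_) (𝕀-set _ _)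

  or-map : {P P′ Q Q′ : Set} → (P → P′) → (Q → Q′) → P or Q → P′ or Q′
  or-map f g = rec (inl ∘ f) (inr ∘ g) (λ (p , q) → glue (f p , g q))

  -- Both Λ²₀ and Λ²₁ are the union of the edge 0 → 1 with the graph of a map α.
  module Horn (α : 𝕀 → 𝕀) (≤α : ∀ j → j ≤ α j) where

    edge : 𝕀 → Δ²
    edge j = (α j , j) , ≤α j

    Λ : Set
    Λ = Σ[ ((i , j) , _) ∈ Δ² ] (i ≡ α j or j ≡ 0ᴵ)

    module _ (B : 𝕀 × 𝕀 → Set ℓ) where

      -- The other edge of a horn with edge `x`. The two meet only in `(α 0ᴵ , 0ᴵ)`, which is the
      -- vertex 0 for `Λ₀` and the vertex 1 for `Λ₁`.
      Cone : (∀ i → B (i , 0ᴵ)) → Set ℓ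
      Cone x = Σ[ z ∈ (∀ j → B (α j , j)) ] x (α 0ᴵ) ≡ z 0ᴵ

      private
        OnGraph On₀₁ : Δ² → Set
        OnGraph ((i , j) , _) = i ≡ α j
        On₀₁ ((i , j) , _) = j ≡ 0ᴵ

        graph-equiv : isEquiv {B = Σ Δ² OnGraph} (λ j → edge j , refl)
        graph-equiv = quasiInverse _ (λ (((_ , j) , _) , _) → j) (λ _ → refl)
          (λ { (_ , refl) → cong (λ p → (_ , p) , refl) (𝕀-set _ _) })

        edge₀₁-equiv : isEquiv {B = Σ Δ² On₀₁} (λ i → edge₀₁ i , refl)
        edge₀₁-equiv = quasiInverse _ (λ (((i , _) , _) , _) → i) (λ _ → refl)
          (λ { (_ , refl) → cong (λ p → (_ , p) , refl) (𝕀-set _ _) })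

        vertex-equiv : isEquiv {A = ⊤} {B = Σ[ s ∈ Δ² ] OnGraph s × On₀₁ s}
                         (λ _ → edge 0ᴵ , refl , refl)
        vertex-equiv = quasiInverse _ _ (λ _ → refl)
          (λ { (_ , refl , refl) → cong (λ p → (_ , p) , refl , refl) (𝕀-set _ _) })

        join : (z : (m : Σ Δ² OnGraph) → B (proj₁ (proj₁ m))) (x : (m : Σ Δ² On₀₁) → B (proj₁ (proj₁ m))) →
               (⊤ → z (edge 0ᴵ , refl) ≡ x (edge 0ᴵ , refl)) →
               x (edge₀₁ (α 0ᴵ) , refl) ≡ z (edge 0ᴵ , refl)
        join z x e =
          trans (cong (λ p → x ((_ , p) , refl)) (𝕀-set (0≤ (α 0ᴵ)) (≤α 0ᴵ))) (sym (e tt))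

        join-equiv : ∀ z x → isEquiv (join z x)
        join-equiv z x = isEquiv-∘ {F = λ e → e tt}
          (quasiInverse _ (λ e _ → e) (λ _ → refl) (λ _ → refl)) (trans-sym-isEquiv _)

      boundary : (∀ (m : Λ) → B (proj₁ (proj₁ m))) → Σ (∀ i → B (i , 0ᴵ)) Cone
      boundary = exchange ∘ split (B ∘ proj₁) OnGraph On₀₁ graph-equiv edge₀₁-equiv vertex-equiv
        (λ z x → x (α 0ᴵ) ≡ z 0ᴵ) join join-equiv

      boundary-isEquiv : isEquiv boundary
      boundary-isEquiv = isEquiv-∘
        (split-isEquiv (B ∘ proj₁) OnGraph On₀₁ graph-equiv edge₀₁-equiv vertex-equiv _ join join-equiv)
        exchange-isEquiv

      ends : Tri B → Σ (∀ i → B (i , 0ᴵ)) Cone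
      -- The two edges reach the common vertex with different proofs of `0ᴵ ≤ α 0ᴵ`.
      ends t = t ∘ edge₀₁ , t ∘ edge , cong (λ p → t (_ , p)) (𝕀-set (0≤ (α 0ᴵ)) (≤α 0ᴵ))

      boundary-ends : ∀ t → boundary (t ∘ proj₁) ≡ ends t
      boundary-ends t = cong (λ e → t ∘ edge₀₁ , t ∘ edge , e)
        -- A section over `Δ²` does not see the proof of the disjunction, so it maps `glue` to a
        -- constant path.
        (trans-sym-const _ (glue (refl , refl)))
        where
        trans-sym-const : ∀ {A : Set a} {C : Set c} {x y : A} {z z′ : C} (q : z ≡ z′) (p : x ≡ y) →
                          trans q (sym (cong (λ _ → z′) p)) ≡ q
        trans-sym-const q refl = trans-reflʳ q

      subst-Cone : ∀ {x x′} (e : x ≡ x′) (w : Cone x) →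
                   subst Cone e w ≡ (proj₁ w , trans (sym (cong-app e (α 0ᴵ))) (proj₂ w))
      subst-Cone refl w = refl

  module Λ₀ = Horn id ≤-refl
  module Λ₁ = Horn (λ _ → 1ᴵ) ≤1

  -- The tetrahedron and its faces.

  Δ³ : Set
  Δ³ = Σ[ (i , j , k) ∈ 𝕀 × 𝕀 × 𝕀 ] j ≤ i × k ≤ j

  Δ³-≡ : ∀ {i i′ j j′ k k′} {p : j ≤ i × k ≤ j} {p′ : j′ ≤ i′ × k′ ≤ j′} →
         i ≡ i′ → j ≡ j′ → k ≡ k′ → _≡_ {A = Δ³} ((i , j , k) , p) ((i′ , j′ , k′) , p′)
  Δ³-≡ refl refl refl = cong₂ (λ p q → _ , p , q) (𝕀-set _ _) (𝕀-set _ _)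

  -- With vertices 0 = (0,0,0), 1 = (1,0,0), 2 = (1,1,0) and 3 = (1,1,1), these are the faces 123,
  -- 013, 023 and 012; thus `d¹` omits 2 and `d²` omits 1.
  d⁰ d¹ d² d³ : Δ² → Δ³
  d⁰ ((j , k) , p) = (1ᴵ , j , k) , ≤1 j , p
  d¹ ((i , j) , p) = (i , j , j) , p , ≤-refl j
  d² ((i , k) , p) = (i , i , k) , ≤-refl i , p
  d³ ((i , j) , p) = (i , j , 0ᴵ) , p , 0≤ j

  On-d⁰ On-d¹ On-d² On-d³ : Δ³ → Set
  On-d⁰ ((i , _ , _) , _) = i ≡ 1ᴵ
  On-d¹ ((_ , j , k) , _) = j ≡ k
  On-d² ((i , j , _) , _) = j ≡ i
  On-d³ ((_ , _ , k) , _) = k ≡ 0ᴵ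

  d⁰-equiv : isEquiv {B = Σ Δ³ On-d⁰} (λ s → d⁰ s , refl)
  d⁰-equiv = quasiInverse _ (λ (((_ , j , k) , _ , p) , _) → (j , k) , p) (λ _ → refl)
    (λ { ((_ , _ , q) , refl) → cong (λ p → (_ , p , q) , refl) (𝕀-set _ _) })

  d¹-equiv : isEquiv {B = Σ Δ³ On-d¹} (λ s → d¹ s , refl)
  d¹-equiv = quasiInverse _ (λ (((i , j , _) , p , _) , _) → (i , j) , p) (λ _ → refl)
    (λ { ((_ , p , _) , refl) → cong (λ q → (_ , p , q) , refl) (𝕀-set _ _) })

  d²-equiv : isEquiv {B = Σ Δ³ On-d²} (λ s → d² s , refl)
  d²-equiv = quasiInverse _ (λ (((i , _ , k) , _ , q) , e) → (i , k) , subst (k ≤_) e q) (λ _ → refl)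
    (λ { ((_ , _ , q) , refl) → cong (λ p → (_ , p , q) , refl) (𝕀-set _ _) })

  d³-equiv : isEquiv {B = Σ Δ³ On-d³} (λ s → d³ s , refl)
  d³-equiv = quasiInverse _ (λ (((i , j , _) , p , _) , _) → (i , j) , p) (λ _ → refl)
    (λ { ((_ , p , _) , refl) → cong (λ q → (_ , p , q) , refl) (𝕀-set _ _) })

  d⁰∩d¹-equiv : isEquiv {B = Σ[ s ∈ Δ³ ] On-d⁰ s × On-d¹ s} (λ j → d⁰ (edge₀₂ j) , refl , refl)
  d⁰∩d¹-equiv = quasiInverse _ (λ (((_ , j , _) , _) , _) → j) (λ _ → refl)
    (λ { (_ , refl , refl) → cong₂ (λ p q → (_ , p , q) , refl , refl) (𝕀-set _ _) (𝕀-set _ _) })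

  d²∩d³-equiv : isEquiv {B = Σ[ s ∈ Δ³ ] On-d² s × On-d³ s} (λ i → d² (edge₀₁ i) , refl , refl)
  d²∩d³-equiv = quasiInverse _ (λ (((i , _) , _) , _) → i) (λ _ → refl)
    (λ { (_ , refl , refl) → cong₂ (λ p q → (_ , p , q) , refl , refl) (𝕀-set _ _) (𝕀-set _ _) })

  d⁰∪d¹ d²∪d³ : Δ³ → Set
  d⁰∪d¹ s = On-d⁰ s or On-d¹ s
  d²∪d³ s = On-d² s or On-d³ s

  -- The condition of isLCC, with the horn given by its two edges.
  hasFillers : (D : 𝕀 → Set ℓ) → (∀ i → D i) → Set ℓ
  hasFillers D x = ∀ w → isContr (fiber (Λ₀.ends (D ∘ proj₁)) (x , w))

  -- This follows from the computation rules of `rec`. As `Λ²₀` lists the diagonal first, `copair`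
  -- is glued along `sym p`, and `boundary` inverts the path again.
  boundary-copair : (D : 𝕀 → Set ℓ) (x y : ∀ i → D i) (p : x 0ᴵ ≡ y 0ᴵ) →
                    Λ₀.boundary (D ∘ proj₁) (copair D x y p) ≡ (x , y , p)
  boundary-copair D x y p =
    Σ-≡ (λ i → rec-inr (λ _ → y i) (λ _ → x i) _ refl)
        (λ i → rec-inl (λ _ → y i) (λ _ → x i) _ refl)
        (coherence (𝕀-set (0≤ 0ᴵ) (≤-refl 0ᴵ)) (cong (rec (λ _ → y 0ᴵ) (λ _ → x 0ᴵ) _) (glue (refl , refl)))
          _ _ p (rec-glue (λ _ → y 0ᴵ) (λ _ → x 0ᴵ) _ (refl , refl)))
    where
    Σ-≡ : ∀ {x x′ y y′ : ∀ i → D i} {p : x 0ᴵ ≡ y 0ᴵ} {p′ : x′ 0ᴵ ≡ y′ 0ᴵ}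
          (u : ∀ i → x i ≡ x′ i) (v : ∀ i → y i ≡ y′ i) →
          trans p (v 0ᴵ) ≡ trans (u 0ᴵ) p′ → _≡_ {A = Σ _ (Λ₀.Cone (D ∘ proj₁))} (x , y , p) (x′ , y′ , p′)
    Σ-≡ {x} {x′} {y} {y′} {p} {p′} u v =
      homotopy-induction (λ x′ u → ∀ p′ → trans p (v 0ᴵ) ≡ trans (u 0ᴵ) p′ → (x , y , p) ≡ (x′ , y′ , p′))
        (homotopy-induction (λ y′ v → ∀ p′ → trans p (v 0ᴵ) ≡ p′ → (x , y , p) ≡ (x , y′ , p′))
          (λ p′ e → cong (λ p → x , y , p) (trans (sym (trans-reflʳ p)) e)) v)
        u p′
    coherence : ∀ {P : Set} {a b : P} {E : Set ℓ′} {x x′ y y′ : E} (e : a ≡ b)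
                (g : y′ ≡ x′) (u : x′ ≡ x) (v : y′ ≡ y) (p : x ≡ y) →
                trans g u ≡ trans v (sym p) →
                trans (trans (cong (λ _ → x′) e) (sym g)) v ≡ trans u p
    coherence refl refl refl v refl s = trans (sym (trans-reflʳ v)) (sym s)

  isLCC⇒hasFillers : (D : 𝕀 → Set ℓ) {x : ∀ i → D i} → isLCC D x → hasFillers D x
  isLCC⇒hasFillers D {x} x-lcc (y , p) =
    subst (λ f → isContr (fiber f (x , y , p))) (funext (Λ₀.boundary-ends (D ∘ proj₁)))
      (fiber-∘ {F = λ t → t ∘ ι₀} {G = boundary}
        -- Since `boundary` is an equivalence, every horn with these edges equals `copair D x y p`.
        (λ k e → subst (λ k → isContr (fiber (λ (t : Tri (D ∘ proj₁)) → t ∘ ι₀) k))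
          (cong proj₁ (isContr⇒≡ (boundary-equiv (x , y , p)) (copair D x y p , boundary-copair D x y p) (k , e)))
          (x-lcc y p))
        (boundary-equiv (x , y , p)))
    where
    boundary = Λ₀.boundary (D ∘ proj₁)
    boundary-equiv = Λ₀.boundary-isEquiv (D ∘ proj₁)

  -- Inner families: extension over the tetrahedron.

  module Families {X : Set a} (A : X → Set b) (inner : isInner A) where

    ι₁-orthogonal : (σ : Δ² → X) → isEquiv (λ (t : ∀ s → A (σ s)) (m : Λ²₁) → t (ι₁ m))
    ι₁-orthogonal σ g = extension-contr A ι₁ σ g (inner _)

    private
      inner-horn : 𝕀 × Δ² → Set
      inner-horn (_ , (i , j) , _) = i ≡ 1ᴵ or j ≡ 0ᴵ

      inner-horn-orthogonal : (σ : 𝕀 × Δ² → X) → isEquiv (restrict (A ∘ σ) inner-horn)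
      inner-horn-orthogonal σ = quasiInverse _
        (λ g (k , s) → inv ∏-equiv (λ k (s , o) → g ((k , s) , o)) k s)
        (λ t → cong (λ t (k , s) → t k s) (inv∘f ∏-equiv (λ k s → t (k , s))))
        (λ g → cong (λ g ((k , s) , o) → g k (s , o)) (f∘inv ∏-equiv (λ k (s , o) → g ((k , s) , o))))
        where
        ∏-equiv : isEquiv (λ (t : ∀ k s → A (σ (k , s))) k (m : Λ²₁) → t k (ι₁ m))
        ∏-equiv = ∏-isEquiv (λ k → ι₁-orthogonal (λ s → σ (k , s)))

    -- Joining with `k` maps `Δ²` to the slice of `Δ³` at `k` and the inner horn into `d⁰` and `d¹`.
    -- The self-map `(i ∨ i₀ , j ∧ j₀)` fixes `(i₀ , j₀)` and preserves the inner horn; after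
    -- joining with `k₀` its values lie in `d⁰` if `i₀` is 1 and in `d¹` if `j₀` is `k₀`.
    d⁰∪d¹-orthogonal : (τ : Δ³ → X) → isEquiv (restrict (A ∘ τ) d⁰∪d¹)
    d⁰∪d¹-orthogonal = Slice.slice A (λ _ → or-isProp 𝕀-set 𝕀-set)
      (λ (k , (i , j) , p) → (i ∨ k , j ∨ k , k) , ∨-mono-≤ p (≤-refl k) , j≤i∨j j k)
      (λ ((i , j , k) , p , q) → k , (i , j) , p)
      (λ ((i , j , k) , p , q) → Δ³-≡ (i≤j⇒j∨i≡j (≤-trans q p)) (i≤j⇒j∨i≡j q) refl)
      (λ (k , _) → or-map (λ { refl → 1∨i≡1 k }) (λ { refl → 0∨i≡i k }))
      (λ ((i₀ , j₀ , k₀) , _) (_ , (i , j) , p) → k₀ , (i ∨ i₀ , j ∧ j₀) , ∧≤∨ p)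
      (λ ((i₀ , j₀ , k₀) , _) → cong (k₀ ,_) (Δ²-≡ (∨-idem i₀) (∧-idem j₀)))
      (λ ((i₀ , j₀ , k₀) , _) _ → or-map (λ { refl → 1∨i≡1 i₀ }) (λ { refl → 0≤ j₀ }))
      (λ ((i₀ , j₀ , k₀) , _) (_ , (i , j) , _) →
        or-map (λ { refl → trans (cong (_∨ k₀) (trans (∨-comm i 1ᴵ) (1∨i≡1 i))) (1∨i≡1 k₀) })
               (λ { refl → [i∧j]∨j≡j j j₀ }))
      inner-horn-orthogonal

    -- Dually, meeting with `i` maps `Δ²` to the slice at `i`, and the horn edges `j = 1` and
    -- `k = 0` into `d²` and `d³`.
    d²∪d³-orthogonal : (τ : Δ³ → X) → isEquiv (restrict (A ∘ τ) d²∪d³)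
    d²∪d³-orthogonal = Slice.slice A (λ _ → or-isProp 𝕀-set 𝕀-set)
      (λ (i , (j , k) , p) → (i , j ∧ i , k ∧ i) , i∧j≤j j i , ∧-mono-≤ p (≤-refl i))
      (λ ((i , j , k) , p , q) → i , (j , k) , q)
      (λ ((i , j , k) , p , q) → Δ³-≡ refl p (≤-trans q p))
      (λ (i , _) → or-map (λ { refl → 1∧i≡i i }) (λ { refl → 0≤ i }))
      (λ ((i₀ , j₀ , k₀) , _) (_ , (j , k) , p) → i₀ , (j ∨ j₀ , k ∧ k₀) , ∧≤∨ p)
      (λ ((i₀ , j₀ , k₀) , _) → cong (i₀ ,_) (Δ²-≡ (∨-idem j₀) (∧-idem k₀)))
      (λ ((i₀ , j₀ , k₀) , _) _ → or-map (λ { refl → 1∨i≡1 j₀ }) (λ { refl → 0≤ k₀ }))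
      (λ ((i₀ , j₀ , k₀) , _) (_ , (j , k) , _) →
        or-map (λ { refl → [i∨j]∧j≡j j j₀ })
               (λ { refl → trans (cong (_∧ i₀) (trans (∧-comm k 0ᴵ) (0≤ k))) (0≤ i₀) }))
      inner-horn-orthogonal

    -- Associativity over a square.

    module Square (h : 𝕀 × 𝕀 → X) where

      private
        B : 𝕀 × 𝕀 → Set b
        B = A ∘ h

        B⁰ B² : 𝕀 × 𝕀 → Set b
        B⁰ (j , _) = B (1ᴵ , j)
        B² (i , _) = B (i , i)

        -- Tetrahedra over `(i , j , k) ↦ h (i , j)`: the vertices 2 and 3 have the same image, and
        -- the edge 2 → 3 is vertical.
        Tet : Set b
        Tet = (s : Δ³) → B (proj₁ (proj₁ s) , proj₁ (proj₂ (proj₁ s)))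

        e₀₁ : Tri B → ∀ i → B (i , 0ᴵ)
        e₀₁ t = t ∘ edge₀₁

        e₁₂ : Tri B → ∀ j → B (1ᴵ , j)
        e₁₂ t = t ∘ edge₁₂

        e₀₂ : Tri B → ∀ i → B (i , i)
        e₀₂ t = t ∘ edge₀₂

        const-homotopy : ∀ {K : Set} {C : K → Set ℓ} {f : ∀ k → C k} (p : ∀ k → f k ≡ f k) →
                         (∀ k → p k ≡ refl) → fromHomotopy p ≡ refl
        const-homotopy p e = trans (cong fromHomotopy (funext e)) fromHomotopy-refl

        cong-const : ∀ {K : Set ℓ} {C : Set ℓ′} {x y : K} (p : x ≡ y) {z : C} → cong (λ _ → z) p ≡ refl
        cong-const refl = refl

      ends₁-isEquiv : isEquiv (Λ₁.ends B)
      ends₁-isEquiv = subst isEquiv (funext (Λ₁.boundary-ends B))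
        (isEquiv-∘ (ι₁-orthogonal (h ∘ proj₁)) (Λ₁.boundary-isEquiv B))

      faces₀₁ : Tet → Σ[ t ∈ Tri B ] Σ[ c ∈ Tri B⁰ ] c ∘ edge₀₂ ≡ e₁₂ t
      faces₀₁ T = T ∘ d¹ , T ∘ d⁰ , refl

      faces₂₃ : Tet → Σ[ t ∈ Tri B ] Σ[ c ∈ Tri B² ] c ∘ edge₀₁ ≡ e₀₂ t
      faces₂₃ T = T ∘ d³ , T ∘ d² , refl

      -- The faces 123 and 013 meet in the edge 1 → 3. The path that `split` produces there is the
      -- image of `glue` under a constant function, hence `refl`.
      faces₀₁-isEquiv : isEquiv faces₀₁
      faces₀₁-isEquiv = subst isEquiv
        (funext λ T → cong (λ e → T ∘ d¹ , T ∘ d⁰ , e)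
          (const-homotopy {f = λ i → T (d¹ (edge₁₂ i))} _ λ _ → cong-const (glue (refl , refl))))
        (isEquiv-∘ (d⁰∪d¹-orthogonal (λ ((i , j , _) , _) → h (i , j)))
          (isEquiv-∘
            (split-isEquiv (λ ((i , j , _) , _) → B (i , j)) On-d⁰ On-d¹ d⁰-equiv d¹-equiv d⁰∩d¹-equiv
              (λ c t → c ∘ edge₀₂ ≡ e₁₂ t) (λ _ _ → fromHomotopy) (λ _ _ → fromHomotopy-isEquiv))
            exchange-isEquiv))

      faces₂₃-isEquiv : isEquiv faces₂₃
      faces₂₃-isEquiv = subst isEquiv
        (funext λ T → cong (λ e → T ∘ d³ , T ∘ d² , e)
          (const-homotopy {f = λ i → T (d³ (edge₀₂ i))} _ λ _ → cong-const (glue (refl , refl))))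
        (isEquiv-∘ (d²∪d³-orthogonal (λ ((i , j , _) , _) → h (i , j)))
          (isEquiv-∘
            (split-isEquiv (λ ((i , j , _) , _) → B (i , j)) On-d² On-d³ d²-equiv d³-equiv d²∩d³-equiv
              (λ c t → c ∘ edge₀₁ ≡ e₀₂ t) (λ _ _ → fromHomotopy) (λ _ _ → fromHomotopy-isEquiv))
            exchange-isEquiv))

      private
        ε : 0≤ 0ᴵ ≡ ≤-refl 0ᴵ
        ε = 𝕀-set _ _

        TriPair : Set b
        TriPair = Σ[ t₀ ∈ Tri B ] Σ[ t ∈ Tri B ] e₀₁ t ≡ e₀₁ t₀

        faces₁₃ : Tet → TriPair
        faces₁₃ T = T ∘ d³ , T ∘ d¹ , cong (λ p i → T (_ , 0≤ i , p)) (sym ε)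

        -- Its fiber over `(t₀ , w)` is the type of fillers of the outer horn with edges `e₀₁ t₀`
        -- and `w`, the type to be shown contractible.
        toEdge₀₂ : TriPair → Σ[ t₀ ∈ Tri B ] Λ₀.Cone B (e₀₁ t₀)
        toEdge₀₂ = basechange (Λ₀.ends B) e₀₁

        toEdge₁₂ : TriPair → Σ[ t ∈ Tri B ] Λ₁.Cone B (e₀₁ t)
        toEdge₁₂ = basechange (Λ₁.ends B) e₀₁ ∘ λ (t₀ , t , e) → t , t₀ , sym e

        -- The triangle `t₀` is recovered from its edge 1 → 2 and the edge 0 → 1 of `t` by filling
        -- an inner horn.
        toEdge₁₂-isEquiv : isEquiv toEdge₁₂
        toEdge₁₂-isEquiv = isEquiv-∘
          (quasiInverse _ (λ (t , t₀ , e) → t₀ , t , sym e)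
            (λ { (_ , _ , e) → cong (λ e → _ , _ , e) (sym-involutive e) })
            (λ { (_ , _ , e) → cong (λ e → _ , _ , e) (sym-involutive e) }))
          (λ (t , w) → fiber-basechange (Λ₁.ends B) e₀₁ (ends₁-isEquiv _))

        -- The edge 0 → 2 comes first because `basechange` matches it with `e₁₂ t`.
        flip-ends : Tri B⁰ → Σ[ y ∈ (∀ j → B (1ᴵ , j)) ] Σ[ z ∈ (∀ j → B (1ᴵ , j)) ] z 0ᴵ ≡ y 0ᴵ
        flip-ends c = c ∘ edge₀₂ , c ∘ edge₀₁ , proj₂ (proj₂ (Λ₀.ends B⁰ c))

        start₁₂ : (Σ[ t ∈ Tri B ] Σ[ z ∈ (∀ j → B (1ᴵ , j)) ] z 0ᴵ ≡ e₁₂ t 0ᴵ) →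
                  Σ[ t ∈ Tri B ] Λ₁.Cone B (e₀₁ t)
        start₁₂ (t , z , q) = t , z , trans (proj₂ (proj₂ (Λ₁.ends B t))) (sym q)

        start₁₂-isEquiv : isEquiv start₁₂
        start₁₂-isEquiv = isEquiv-total id-isEquiv λ t → isEquiv-total id-isEquiv λ z →
          trans-sym-isEquiv (proj₂ (proj₂ (Λ₁.ends B t)))

        start₀₂ : (Σ[ t ∈ Tri B ] Λ₀.Cone B² (e₀₂ t)) → Σ[ t ∈ Tri B ] Λ₀.Cone B (e₀₁ t)
        start₀₂ (t , y , q) = t , y , trans (proj₂ (proj₂ (Λ₀.ends B t))) q

        start₀₂-isEquiv : isEquiv start₀₂
        start₀₂-isEquiv = isEquiv-total id-isEquiv λ t → isEquiv-total id-isEquiv λ y →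
          trans-isEquiv (proj₂ (proj₂ (Λ₀.ends B t)))

        via-d⁰ : (Σ[ t ∈ Tri B ] Σ[ c ∈ Tri B⁰ ] c ∘ edge₀₂ ≡ e₁₂ t) → Σ[ t ∈ Tri B ] Λ₁.Cone B (e₀₁ t)
        via-d⁰ = start₁₂ ∘ basechange flip-ends e₁₂

        via-d² : (Σ[ t ∈ Tri B ] Σ[ c ∈ Tri B² ] c ∘ edge₀₁ ≡ e₀₂ t) → Σ[ t ∈ Tri B ] Λ₀.Cone B (e₀₁ t)
        via-d² = start₀₂ ∘ basechange (Λ₀.ends B²) e₀₂

        -- Both sides consist of the face 013 and the edge 1 → 2 of `T`; only the paths at the
        -- vertex 1, built from proofs of inequalities, have to be compared.
        toEdge₁₂-faces : ∀ T → via-d⁰ (faces₀₁ T) ≡ toEdge₁₂ (faces₁₃ T)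
        toEdge₁₂-faces T = cong (T ∘ d¹ ,_)
          (sym (trans (Λ₁.subst-Cone B _ _) (cong (e₁₂ (T ∘ d³) ,_) (coherence ε (𝕀-set _ _)))))
          where
          coherence : ∀ {p q} (ε : 0≤ 0ᴵ ≡ p) (η : 0≤ 1ᴵ ≡ q) →
                      trans (sym (cong-app (sym (cong (λ p i → T (_ , 0≤ i , p)) (sym ε))) 1ᴵ))
                            (cong (λ q → T (_ , q , 0≤ 0ᴵ)) η) ≡
                      trans (cong (λ q → T (_ , q , p)) η) (sym (cong (λ p → T (_ , q , p)) ε))
          coherence refl refl = refl

        toEdge₀₂-faces : ∀ T → via-d² (faces₂₃ T) ≡ toEdge₀₂ (faces₁₃ T)
        toEdge₀₂-faces T = cong (T ∘ d³ ,_)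
          (sym (trans (Λ₀.subst-Cone B _ _) (cong (e₀₂ (T ∘ d¹) ,_) (coherence ε))))
          where
          coherence : ∀ {p} (ε : 0≤ 0ᴵ ≡ p) →
                      trans (sym (cong-app (cong (λ p i → T (_ , 0≤ i , p)) (sym ε)) 0ᴵ))
                            (cong (λ q → T (_ , q , p)) ε) ≡
                      trans (cong (λ q → T (_ , q , 0≤ 0ᴵ)) ε) (cong (λ q → T (_ , p , q)) ε)
          coherence refl = refl

        -- By `toEdge₁₂-isEquiv` it suffices to prescribe the face 013 and the edge 1 → 2. The
        -- tetrahedron is determined by its faces 013 and 123, and `fillers` gives a unique face 123
        -- with the edges 1 → 2 and 1 → 3.
        faces₁₃-contr : ∀ t₀ → hasFillers (λ j → B (1ᴵ , j)) (e₁₂ t₀) →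
                        ∀ t e → isContr (fiber faces₁₃ (t₀ , t , e))
        faces₁₃-contr t₀ fillers t e = fiber-cancelˡ {F = faces₁₃} {G = toEdge₁₂} toEdge₁₂-isEquiv
          (subst (λ f → isContr (fiber f (toEdge₁₂ (t₀ , t , e)))) (funext toEdge₁₂-faces)
            (fiber-∘ {F = faces₀₁} {G = via-d⁰} (λ y _ → faces₀₁-isEquiv y)
              (fiber-∘ {F = basechange flip-ends e₁₂} {G = start₁₂}
                (λ (t′ , z , q) p → fiber-basechange flip-ends e₁₂ (flip-contr
                  (trans (cong (proj₁ ∘ proj₂) p) (cong proj₁ (Λ₁.subst-Cone B (sym e) _))) q))
                (start₁₂-isEquiv _))))
          where
          flip-contr : ∀ {y z} → z ≡ e₁₂ t₀ → (q : z 0ᴵ ≡ y 0ᴵ) → isContr (fiber flip-ends (y , z , q))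
          flip-contr refl q = isContr-retract
            (λ (c , p) → c , cong exchange p)
            (λ (c , p) → c , cong exchange p)
            (λ (c , p) → cong (c ,_) (exchange-involutive p))
            (fillers (_ , q))
            where
            exchange-involutive : ∀ {m n} (p : m ≡ n) → cong exchange (cong exchange p) ≡ p
            exchange-involutive refl = refl

      -- Tetrahedra with face 012 equal to `t₀` and edge 0 → 3 given by `w` amount to a face 023,
      -- which is unique by `fillers₀₂`. By `faces₁₃-contr` they also amount to their face 013,
      -- which is the filler sought.
      ends-contr : ∀ t₀ → hasFillers (λ j → B (1ᴵ , j)) (e₁₂ t₀) → hasFillers (λ i → B (i , i)) (e₀₂ t₀) →
                   ∀ w → isContr (fiber (Λ₀.ends B) (e₀₁ t₀ , w))
      ends-contr t₀ fillers₁₂ fillers₀₂ w = fiber-basechange⁻ (Λ₀.ends B) e₀₁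
        (fiber-cancelʳ {F = faces₁₃} {G = toEdge₀₂}
          (λ (t , t′ , e) p → faces₁₃-contr t
            (subst (λ t → hasFillers (λ j → B (1ᴵ , j)) (e₁₂ t)) (sym (cong proj₁ p)) fillers₁₂) t′ e)
          (subst (λ f → isContr (fiber f (t₀ , w))) (funext toEdge₀₂-faces)
            (fiber-∘ {F = faces₂₃} {G = via-d²} (λ y _ → faces₂₃-isEquiv y)
              (fiber-∘ {F = basechange (Λ₀.ends B²) e₀₂} {G = start₀₂}
                (λ (t , y , q) p → fiber-basechange (Λ₀.ends B²) e₀₂
                  (subst (λ t → hasFillers (λ i → B (i , i)) (e₀₂ t)) (sym (cong proj₁ p)) fillers₀₂ (y , q)))
                (start₀₂-isEquiv _)))))

    -- From locally cocartesian to cocartesian edges.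

    module _ (lifts : hasLCCLifts A) (compose : LCCLiftsCompose A) where

      private
        Extends : (Δ² → X) → Set b
        Extends σ = (g : (m : Λ²₀) → A (σ (ι₀ m))) →
          isLCC (A ∘ σ ∘ edge₀₁) (g ∘ edge₀₁-Λ²₀) →
          isContr (fiber (λ (t : ∀ s → A (σ s)) → t ∘ ι₀) g)

        extends-square : (h : 𝕀 × 𝕀 → X) → Extends (h ∘ proj₁)
        extends-square h g x-lcc =
          -- The triangle `t₀` composes `x` with a locally cocartesian lift `z` of the edge 1 → 2.
          let z , z₀ , z-lcc = lifts (λ j → h (1ᴵ , j)) (x 1ᴵ)
              t₀ , e = proj₁ (ends₁-isEquiv (x , z , sym z₀))
          in fiber-cancelˡ {F = λ (t : Tri (A ∘ h)) → t ∘ ι₀} {G = Λ₀.boundary (A ∘ h)}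
               (Λ₀.boundary-isEquiv (A ∘ h))
               (subst (λ f → isContr (fiber f (Λ₀.boundary (A ∘ h) g)))
                 (sym (funext (Λ₀.boundary-ends (A ∘ h)))) (go t₀ e x-lcc z-lcc _))
          where
          open Square h
          x : ∀ i → A (h (i , 0ᴵ))
          x = g ∘ edge₀₁-Λ²₀
          go : ∀ t₀ {x z p} → Λ₁.ends (A ∘ h) t₀ ≡ (x , z , p) →
               isLCC (λ i → A (h (i , 0ᴵ))) x → isLCC (λ j → A (h (1ᴵ , j))) z →
               ∀ w → isContr (fiber (Λ₀.ends (A ∘ h)) (x , w))
          -- Once `x` and `z` are edges of `t₀` by definition, `compose` applies to its edge 0 → 2.
          go t₀ refl x-lcc z-lcc = ends-contr t₀ (isLCC⇒hasFillers _ z-lcc)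
            (isLCC⇒hasFillers _ (compose h t₀ x-lcc z-lcc))

        extends : ∀ σ → Extends σ
        extends σ = subst Extends
          (funext λ ((i , j) , p) → cong σ (Δ²-≡ refl p))
          -- Composition is assumed over squares, so `σ` is precomposed with the retraction
          -- `(i , j ∧ i)` of the square onto `Δ²`.
          (extends-square (λ (i , j) → σ ((i , j ∧ i) , i∧j≤j j i)))

        extends-gap : ∀ σ {g₁ : Λ²₀ → X} (e : σ ∘ ι₀ ≡ g₁) (g₂ : ∀ m → A (g₁ m)) →
          isLCC (A ∘ g₁ ∘ edge₀₁-Λ²₀) (g₂ ∘ edge₀₁-Λ²₀) →
          isContr (fiber (gap A ι₀) (σ , (λ m → g₁ m , g₂ m) , e))
        extends-gap σ refl g₂ x-lcc = gap-contr A ι₀ σ g₂ (extends σ g₂ x-lcc)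

      -- By path induction `f` is the restriction of a point `P` of the gap. The fiber of `onFibers`
      -- over `(P , refl)` is then a retract of the fiber of `gap` over `P`.
      isLCC⇒isCocartesianArrow : (f : 𝕀 → Σ X A) → isLCC (A ∘ proj₁ ∘ f) (proj₂ ∘ f) →
                                 isCocartesianArrow A f
      isLCC⇒isCocartesianArrow f x-lcc (P@(σ , g , e) , refl) = isContr-retract
        (λ ((t , _) , e) → t , cong proj₁ e)
        (λ (t , e) → (t , cong (restrict₀₁ A) e) , pair e)
        (λ { (_ , refl) → refl })
        (extends-gap σ e (proj₂ ∘ g) x-lcc)
        where
        pair : ∀ {t P} (e : gap A ι₀ t ≡ P) →
               _≡_ {A = fiber (restrict₀₁ A) (restrict₀₁ A P)}
                 (gap A ι₀ t , cong (restrict₀₁ A) e) (P , refl)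
        pair refl = refl

theorem3p6 : (H : HoTT) (I : Interval) →
  let open Interval I using (𝕀)
      open SimplicialTypeTheory H I
  in
  {a b : Level} (X : Set a) (A : X → 𝓤Simp b) →
  isIsoInner (El ∘ A) → hasLCCLifts (El ∘ A) → LCCLiftsCompose (El ∘ A) →
    ((u : 𝕀 → X) (x : ∀ i → El (A (u i))) →
       isLCC (El ∘ A ∘ u) x → isCocartesianArrow (El ∘ A) (total (El ∘ A) u x))
    × isCocartesianFamily (El ∘ A)
theorem3p6 H I X A iso-inner lifts compose =
    lcc⇒cocartesian
  , iso-inner , (λ x → proj₂ (A x))
  , λ u x₀ → let x , x₀≡ , x-lcc = lifts u x₀ in x , x₀≡ , lcc⇒cocartesian u x x-lcc
  where
  open SimplicialTypeTheory H I
  lcc⇒cocartesian : ∀ u x → isLCC (El ∘ A ∘ u) x → isCocartesianArrow (El ∘ A) (total (El ∘ A) u x)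
  lcc⇒cocartesian u x =
    Fillers.Families.isLCC⇒isCocartesianArrow H I (El ∘ A) (proj₁ iso-inner) lifts compose _
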